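{- Let $k\ge 2$ and let $G\cong K_{r_1,r_2,\ldots,r_k}$ be a complete $k$-partite graph such that $r_1=r_2=\cdots=r_k\ge 2$ and $\sum_{i=1}^k r_i=n$. Then $\dim_{ms}(G)=n-1$.
   Context: For a simple connected graph $G$, $d_G(u,v)$ is the length of a shortest $u$–$v$ path. For $S=\{w_1,\ldots,w_t\}\subseteq V(G)$ and $u\in V(G)$, the multiset representation of $u$ with respect to $S$ is the multiset $\operatorname{m}(u|S)$ consisting of $d_G(u,w_1),\ldots,d_G(u,w_t)$, counted with multiplicity. A set $S$ is an outer multiset resolving set if $\operatorname{m}(u|S)\ne \operatorname{m}(v|S)$ for every two distinct $u,v\in V(G)\setminus S$; the outer multiset dimension $\dim_{ms}(G)$ is the minimum cardinality of such a set. $K_{r_1,\ldots,r_k}$ is the complete $k$-partite graph with parts of sizes $r_1,\ldots,r_k$. -}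

module Defs where

open import Data.Empty using (⊥-elim)
open import Data.Fin using (Fin)
open import Data.Fin.Properties using (_≟_; any?; all?)
open import Data.Fin.Subset using (Subset; _∈_; _∉_; ∣_∣; ⊤)
open import Data.Fin.Subset.Properties using (_∈?_; ∈⊤; anySubset?)
open import Data.List using (List; []; _∷_; _++_; map; filter; allFin)
open import Data.List.Membership.DecPropositional using () renaming (_∈?_ to memberOf?)
open import Data.List.Membership.Propositional.Properties using (∈-∃++)
open import Data.List.Relation.Binary.Permutation.Propositional
  using (_↭_; ↭-refl; ↭-sym; ↭-trans; prep)
open import Data.List.Relation.Binary.Permutation.Propositional.Properties
  using (∈-resp-↭; drop-∷; shift; ¬x∷xs↭[])
open import Data.List.Relation.Unary.Any using (here)
open import Data.Nat using (ℕ; zero; suc; _≤_; z≤n; s≤s)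
import Data.Nat.Properties as ℕ
open import Data.Product using (Σ; ∃; _×_; _,_; proj₁; proj₂)
open import Data.Vec using (Vec; []; _∷_; head; last; lookup)
open import Data.Vec.Relation.Unary.AllPairs using (allPairs?)
open import Data.Vec.Relation.Unary.Linked using (Linked; linked?)
open import Data.Vec.Relation.Unary.Unique.Propositional using (Unique)
open import Function using (_∘_)
open import Function.Bundles using (_↔_; _⇔_; Inverse)
open import Relation.Binary using (Symmetric; Irreflexive)
import Relation.Binary as Binary
open import Relation.Binary.PropositionalEquality using (_≡_; _≢_; refl; ≢-sym)
open import Relation.Nullary using (Dec; yes; no; ¬_; ¬?)
open import Relation.Nullary.Decidable using (_×-dec_; _→-dec_; map′)
open import Relation.Unary using (Decidable)

IsMinimum : (ℕ → Set) → ℕ → Set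
IsMinimum P m = P m × (∀ k → P k → m ≤ k)

minimum : {P : ℕ → Set} → Decidable P → ∃ P → ∃ (IsMinimum P)
minimum P? (n , Pn) = search P? n Pn
  where
  search : {P : ℕ → Set} → Decidable P → ∀ n → P n → ∃ (IsMinimum P)
  search P? zero Pn = zero , Pn , λ _ _ → z≤n
  search {P} P? (suc n) Pn with P? zero
  ... | yes P0 = zero , P0 , λ _ _ → z≤n
  ... | no ¬P0 with search {P ∘ suc} (P? ∘ suc) n Pn
  ...   | m , Pm , below = suc m , Pm , below′
    where
    below′ : ∀ k → P k → suc m ≤ k
    below′ zero    P0 = ⊥-elim (¬P0 P0)
    below′ (suc k) Pk = s≤s (below k Pk)

anyVec? : ∀ {n} ℓ {P : Vec (Fin n) ℓ → Set} → Decidable P → Dec (∃ P)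
anyVec? zero    P? = map′ ([] ,_) (λ { ([] , p) → p }) (P? [])
anyVec? (suc ℓ) P? =
  map′ (λ { (x , xs , p) → x ∷ xs , p }) (λ { (x ∷ xs , p) → x , xs , p })
       (any? λ x → anyVec? ℓ λ xs → P? (x ∷ xs))

_↭?_ : Binary.Decidable (_↭_ {A = ℕ})
[]       ↭? []       = yes ↭-refl
[]       ↭? (_ ∷ _)  = no λ p → ¬x∷xs↭[] (↭-sym p)
(x ∷ xs) ↭? ys with memberOf? ℕ._≟_ x ys
... | no x∉ys  = no λ p → x∉ys (∈-resp-↭ p (here refl))
... | yes x∈ys with ∈-∃++ x∈ys
...   | as , bs , refl =
  map′ (λ p → ↭-trans (prep x p) (↭-sym (shift x as bs)))
       (λ p → drop-∷ (↭-trans p (shift x as bs)))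
       (xs ↭? (as ++ bs))

record SimpleGraph (V : Set) : Set₁ where
  field
    Adj    : V → V → Set
    adj?   : Binary.Decidable Adj
    sym    : Symmetric Adj
    irrefl : Irreflexive _≡_ Adj

record _≅_ {V W : Set} (G : SimpleGraph V) (H : SimpleGraph W) : Set where
  private
    module G = SimpleGraph G
    module H = SimpleGraph H
  field
    bijection : V ↔ W
  open Inverse bijection using (to)
  field
    adj⇔ : ∀ u v → G.Adj u v ⇔ H.Adj (to u) (to v)

-- The j-th vertex of the i-th part is (i , j).
completeMultipartite : ∀ {k} (r : Vec ℕ k) →
                       SimpleGraph (Σ (Fin k) λ i → Fin (lookup r i))
completeMultipartite r = record
  { Adj    = λ u v → proj₁ u ≢ proj₁ v
  ; adj?   = λ u v → ¬? (proj₁ u ≟ proj₁ v)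
  ; sym    = ≢-sym
  ; irrefl = λ { refl i≢i → i≢i refl }
  }

module _ {n : ℕ} (G : SimpleGraph (Fin n)) where
  open SimpleGraph G

  -- Length counts edges, so a path of length ℓ visits suc ℓ vertices.
  Path : Fin n → Fin n → ℕ → Set
  Path u v ℓ = ∃ λ (xs : Vec (Fin n) (suc ℓ)) →
    Linked Adj xs × Unique xs × head xs ≡ u × last xs ≡ v

  path? : ∀ u v → Decidable (Path u v)
  path? u v ℓ = anyVec? (suc ℓ) λ xs →
    linked? adj? xs ×-dec allPairs? (λ x y → ¬? (x ≟ y)) xs ×-dec
    head xs ≟ u ×-dec last xs ≟ v

  Connected : Set
  Connected = ∀ u v → ∃ (Path u v)

record ConnectedGraph (n : ℕ) : Set₁ where
  field
    graph     : SimpleGraph (Fin n)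
    connected : Connected graph

module _ {n : ℕ} (G : ConnectedGraph n) where
  open ConnectedGraph G

  shortestPath : ∀ u v → ∃ (IsMinimum (Path graph u v))
  shortestPath u v = minimum (path? graph u v) (connected u v)

  dist : Fin n → Fin n → ℕ
  dist u v = proj₁ (shortestPath u v)

  -- Multisets of naturals are lists compared up to permutation _↭_.
  multisetRep : Fin n → Subset n → List ℕ
  multisetRep u S = map (dist u) (filter (_∈? S) (allFin n))

  OuterMultisetResolving : Subset n → Set
  OuterMultisetResolving S =
    ∀ u v → u ∉ S → v ∉ S → u ≢ v → ¬ (multisetRep u S ↭ multisetRep v S)

  outerMultisetResolving? : Decidable OuterMultisetResolving
  outerMultisetResolving? S = all? λ u → all? λ v →
    ¬? (u ∈? S) →-dec ¬? (v ∈? S) →-dec ¬? (u ≟ v) →-dec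
    ¬? (multisetRep u S ↭? multisetRep v S)

  ResolvingCardinality : ℕ → Set
  ResolvingCardinality t = ∃ λ S → OuterMultisetResolving S × ∣ S ∣ ≡ t

  minimumResolving : ∃ (IsMinimum ResolvingCardinality)
  minimumResolving = minimum
    (λ t → anySubset? λ S → outerMultisetResolving? S ×-dec ∣ S ∣ ℕ.≟ t)
    (∣ ⊤ {n} ∣ , ⊤ , (λ _ _ u∉⊤ → ⊥-elim (u∉⊤ ∈⊤)) , refl)

  dimₘₛ : ℕ
  dimₘₛ = proj₁ minimumResolving

{-# OPTIONS --safe #-}
-- If φ is an involutive automorphism preserving S with φ u = v, then u and v have the same
-- multiset representation.  Two vertices u, v of the same part, both outside S, are exchanged
-- by a transposition, so a resolving set misses at most one vertex of each part.  If it misses u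
-- and v in different parts, then these parts have equal size, and exchanging them in a way that
-- exchanges u and v preserves S.  Hence a resolving set misses at most one vertex.
module Submission where

open import Defs
open import Data.Bool using (if_then_else_; _∨_)
open import Data.Fin using (Fin; zero; suc; cast; fromℕ<)
open import Data.Fin.Permutation using (↔⇒≡)
open import Data.Fin.Permutation.Components using (transpose)
open import Data.Fin.Properties using (_≟_; cast-involutive; *↔×)
open import Data.Fin.Subset using (Subset; _∈_; _∉_; ∣_∣; ⊤; ⁅_⁆; ∁; inside; outside)
open import Data.Fin.Subset.Properties
  using (_∈?_; ∣⊤∣≡n; p⊆q⇒∣p∣≤∣q∣; ∣⁅x⁆∣≡1; ∣∁p∣≡n∸∣p∣; x∉∁p⇒x∈p; x∈⁅y⁆⇒x≡y)
open import Data.List using (map; filter; allFin)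
open import Data.List.Membership.Propositional using () renaming (_∈_ to _∈ₗ_)
open import Data.List.Membership.Propositional.Properties
  using (∈-map⁺; ∈-map⁻; ∈-filter⁺; ∈-filter⁻; ∈-allFin)
open import Data.List.Membership.Propositional.Properties.WithK using (unique∧set⇒bag)
open import Data.List.Properties using (map-∘; map-cong)
open import Data.List.Relation.Binary.BagAndSetEquality using (∼bag⇒↭)
open import Data.List.Relation.Binary.Permutation.Propositional
  using (_↭_; module PermutationReasoning)
import Data.List.Relation.Binary.Permutation.Propositional.Properties as ↭
import Data.List.Relation.Unary.Unique.Propositional as List
import Data.List.Relation.Unary.Unique.Propositional.Properties as List
open import Data.Nat using (ℕ; suc; _+_; _*_; _∸_; _≤_; z≤n; s≤s)
open import Data.Nat.Properties using (≤-trans; ≤-antisym; n≤1+n; ∸-monoˡ-≤)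
open import Data.Product using (Σ; _×_; _,_; _,′_; proj₁; proj₂)
open import Data.Vec as Vec using (Vec; []; _∷_; head; last; lookup; sum; here; there)
import Data.Vec.Relation.Unary.Linked as Linked
import Data.Vec.Relation.Unary.Linked.Properties as Linked
import Data.Vec.Relation.Unary.Unique.Propositional.Properties as Unique
open import Function using (_∘_; case_of_)
open import Function.Bundles using (_↔_; Equivalence; Inverse; mk⇔; mk↔ₛ′)
open import Function.Definitions using (Injective)
open import Function.Properties.Inverse using (↔-sym; ↔-trans)
open import Relation.Binary.PropositionalEquality
  using (_≡_; _≢_; refl; sym; trans; cong; cong₂; subst; subst₂)
open import Relation.Nullary using (yes; no; does; contradiction)
open import Relation.Nullary.Decidable using (dec-true; dec-false; decidable-stable)

-- Subsets and cardinalities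

-- Induction along `p`. At the first `outside` entry the one permitted gap is used up, so the rest
-- of `p` contains `⊤`.
∉-unique⇒n≤1+∣p∣ : ∀ {n} (p : Subset n) →
                   (∀ x y → x ∉ p → y ∉ p → x ≡ y) → n ≤ suc ∣ p ∣
∉-unique⇒n≤1+∣p∣ []            _      = z≤n
∉-unique⇒n≤1+∣p∣ (inside ∷ p)  unique = s≤s (∉-unique⇒n≤1+∣p∣ p λ x y x∉p y∉p →
  case unique (suc x) (suc y) (λ { (there x∈p) → x∉p x∈p }) (λ { (there y∈p) → y∉p y∈p })
  of λ { refl → refl })
∉-unique⇒n≤1+∣p∣ {suc n} (outside ∷ p) unique =
  s≤s (subst (_≤ ∣ p ∣) (∣⊤∣≡n n) (p⊆q⇒∣p∣≤∣q∣ {p = ⊤} λ {x} _ →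
    -- A second gap, at `suc x`, would have to equal `zero`.
    decidable-stable (x ∈? p) λ x∉p →
      case unique zero (suc x) (λ ()) (λ { (there x∈p) → x∉p x∈p }) of λ ()))

sum-constant : ∀ {k} (r : Vec ℕ k) s → (∀ i → lookup r i ≡ s) → sum r ≡ k * s
sum-constant []      s _    = refl
sum-constant (_ ∷ r) s r≡s = cong₂ _+_ (r≡s zero) (sum-constant r s (r≡s ∘ suc))

involutive⇒injective : ∀ {A : Set} {f : A → A} → (∀ x → f (f x) ≡ x) → Injective _≡_ _≡_ f
involutive⇒injective {f = f} inv {x} {y} fx≡fy = trans (sym (inv x)) (trans (cong f fx≡fy) (inv y))

-- Automorphisms and multiset representations

head-map : ∀ {A B : Set} (f : A → B) {n} (xs : Vec A (suc n)) → head (Vec.map f xs) ≡ f (head xs)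
head-map f (x ∷ xs) = refl

-- `last` computes through `initLast`, so the equation holds definitionally only once that view of
-- `xs` is opened.
last-∷ : ∀ {A : Set} {n} (x : A) (xs : Vec A (suc n)) → last (x ∷ xs) ≡ last xs
last-∷ x xs with Vec.initLast xs
... | _ , _ , refl = refl

last-map : ∀ {A B : Set} (f : A → B) {n} (xs : Vec A (suc n)) → last (Vec.map f xs) ≡ f (last xs)
last-map f (x ∷ [])       = refl
last-map f (x ∷ xs@(_ ∷ _)) =
  trans (last-∷ (f x) (Vec.map f xs)) (trans (last-map f xs) (cong f (sym (last-∷ x xs))))

module _ {n : ℕ} (G : ConnectedGraph n) where
  open ConnectedGraph G
  open SimpleGraph graph using (Adj)

  module _ (φ : Fin n → Fin n)
           (φ-hom : ∀ x y → Adj x y → Adj (φ x) (φ y))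
           (φ-involutive : ∀ x → φ (φ x) ≡ x) where

    path-map : ∀ {u v ℓ} → Path graph u v ℓ → Path graph (φ u) (φ v) ℓ
    path-map (xs , linked , unique , refl , refl) =
      Vec.map φ xs
      , Linked.map⁺ (Linked.map (φ-hom _ _) linked)
      , Unique.map⁺ (involutive⇒injective φ-involutive) unique
      , head-map φ xs , last-map φ xs

    -- `φ` carries a shortest path to a path of the same length, which bounds the minimum.
    dist-nonincreasing : ∀ u v → dist G (φ u) (φ v) ≤ dist G u v
    dist-nonincreasing u v =
      proj₂ (proj₂ (shortestPath G (φ u) (φ v))) _
        (path-map (proj₁ (proj₂ (shortestPath G u v))))

    dist-invariant : ∀ u v → dist G (φ u) (φ v) ≡ dist G u v
    dist-invariant u v = ≤-antisym (dist-nonincreasing u v)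
      -- As `φ` is its own inverse, the same bound at `φ u` and `φ v` is the reverse inequality.
      (subst₂ (λ x y → dist G x y ≤ dist G (φ u) (φ v)) (φ-involutive u) (φ-involutive v)
        (dist-nonincreasing (φ u) (φ v)))

    module _ (S : Subset n) (φ-∉ : ∀ x → x ∉ S → φ x ∉ S) where

      private
        elements = filter (_∈? S) (allFin n)

        elements-unique : List.Unique elements
        elements-unique = List.filter⁺ (_∈? S) (List.allFin⁺ n)

        φ-elements : ∀ {x} → x ∈ₗ elements → φ x ∈ₗ elements
        φ-elements {x} x∈ = ∈-filter⁺ (_∈? S) (∈-allFin (φ x))
          -- Preserving the complement suffices: if `φ x` lay outside `S`, so would `φ (φ x)`, which
          -- is `x`.
          (decidable-stable (φ x ∈? S) λ φx∉S →
            subst (_∉ S) (φ-involutive x) (φ-∉ (φ x) φx∉S)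
              (proj₂ (∈-filter⁻ (_∈? S) {xs = allFin n} x∈)))

      -- Both lists are free of duplicates and have the same members, hence they agree as bags.
      map-elements-↭ : map φ elements ↭ elements
      map-elements-↭ = ∼bag⇒↭ (unique∧set⇒bag
        (List.map⁺ (involutive⇒injective φ-involutive) elements-unique) elements-unique
        (mk⇔ (λ x∈ → case ∈-map⁻ φ x∈ of λ { (_ , y∈ , refl) → φ-elements y∈ })
             (λ x∈ → subst (_∈ₗ map φ elements) (φ-involutive _) (∈-map⁺ φ (φ-elements x∈)))))

      multisetRep-invariant : ∀ u → multisetRep G u S ↭ multisetRep G (φ u) S
      multisetRep-invariant u = begin
        map (dist G u) elements               ≡⟨ map-cong (dist-invariant u) elements ⟨
        map (dist G (φ u) ∘ φ) elements       ≡⟨ map-∘ elements ⟩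
        map (dist G (φ u)) (map φ elements)   ↭⟨ ↭.map⁺ (dist G (φ u)) map-elements-↭ ⟩
        map (dist G (φ u)) elements           ∎
        where open PermutationReasoning

-- Exchanging two parts

transpose-left : ∀ {n} (i j : Fin n) → transpose i j i ≡ j
transpose-left i j rewrite dec-true (i ≟ i) refl = refl

transpose-right : ∀ {n} (i j : Fin n) → transpose i j j ≡ i
transpose-right i j with j ≟ i
... | yes j≡i = j≡i
... | no  _   rewrite dec-true (j ≟ j) refl = refl

transpose-other : ∀ {n} (i j : Fin n) {k} → k ≢ i → k ≢ j → transpose i j k ≡ k
transpose-other i j {k} k≢i k≢j rewrite dec-false (k ≟ i) k≢i | dec-false (k ≟ j) k≢j = refl

transpose-involutive : ∀ {n} (i j k : Fin n) → transpose i j (transpose i j k) ≡ k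
transpose-involutive i j k with k ≟ i
... | yes refl = transpose-right k j
... | no  k≢i with k ≟ j
...   | yes refl = transpose-left i k
...   | no  k≢j  = transpose-other i j k≢i k≢j

module _ {k s : ℕ} where

  -- For i = j this is the transposition of (i , a) and (i , b).
  swap : (u v w : Fin k × Fin s) → Fin k × Fin s
  swap (i , a) (j , b) (p , x) =
    transpose i j p , (if does (p ≟ i) ∨ does (p ≟ j) then transpose a b x else x)

  module _ (u v : Fin k × Fin s) where

    private
      i = proj₁ u
      j = proj₁ v
      τ = transpose (proj₂ u) (proj₂ v)
      τ-involutive = transpose-involutive (proj₂ u) (proj₂ v)

    swap-left : ∀ x → swap u v (i , x) ≡ (j , τ x)
    swap-left x rewrite dec-true (i ≟ i) refl = refl

    swap-right : ∀ x → swap u v (j , x) ≡ (i , τ x)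
    swap-right x with j ≟ i
    ... | yes j≡i = cong (_, τ x) j≡i
    ... | no  _   rewrite dec-true (j ≟ j) refl = refl

    swap-other : ∀ w → proj₁ w ≢ i → proj₁ w ≢ j → swap u v w ≡ w
    swap-other (p , _) p≢i p≢j rewrite dec-false (p ≟ i) p≢i | dec-false (p ≟ j) p≢j = refl

    swap-involutive : ∀ w → swap u v (swap u v w) ≡ w
    swap-involutive w@(p , x) = case (p ≟ i) ,′ (p ≟ j) of λ where
      (yes refl , _) → trans (cong (swap u v) (swap-left x))
        (trans (swap-right (τ x)) (cong (i ,_) (τ-involutive x)))
      (no _ , yes refl) → trans (cong (swap u v) (swap-right x))
        (trans (swap-left (τ x)) (cong (j ,_) (τ-involutive x)))
      (no p≢i , no p≢j) →
        trans (cong (swap u v) (swap-other w p≢i p≢j)) (swap-other w p≢i p≢j)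

    -- On part indices `swap` is a transposition, which is injective.
    swap-hom : ∀ w w′ → proj₁ w ≢ proj₁ w′ → proj₁ (swap u v w) ≢ proj₁ (swap u v w′)
    swap-hom _ _ p≢p′ = p≢p′ ∘ involutive⇒injective (transpose-involutive i j)

    swap-first : swap u v u ≡ v
    swap-first = trans (swap-left (proj₂ u)) (cong (j ,_) (transpose-left (proj₂ u) (proj₂ v)))

    swap-second : swap u v v ≡ u
    swap-second = trans (swap-right (proj₂ v)) (cong (i ,_) (transpose-right (proj₂ u) (proj₂ v)))

  swap-fixes-same-part : ∀ u v w → proj₁ u ≡ proj₁ v → w ≢ u → w ≢ v → swap u v w ≡ w
  swap-fixes-same-part u@(i , a) v@(_ , b) w@(p , x) refl w≢u w≢v = case p ≟ i of λ where
    (yes refl) → trans (swap-left u v x)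
      (cong (i ,_) (transpose-other a b (w≢u ∘ cong (i ,_)) (w≢v ∘ cong (i ,_))))
    (no p≢i) → swap-other u v w p≢i p≢i

-- Resolving sets of balanced complete multipartite graphs

module _ {k s n : ℕ} (G : ConnectedGraph n) (I : Fin n ↔ (Fin k × Fin s)) where
  open Inverse I using (to; from; strictlyInverseˡ; strictlyInverseʳ)
  open SimpleGraph (ConnectedGraph.graph G) using (Adj)

  private
    part : Fin n → Fin k
    part = proj₁ ∘ to

    to-injective : Injective _≡_ _≡_ to
    to-injective eq = trans (sym (strictlyInverseʳ _)) (trans (cong from eq) (strictlyInverseʳ _))

  module _ (adj⇒ : ∀ u v → Adj u v → part u ≢ part v)
           (adj⇐ : ∀ u v → part u ≢ part v → Adj u v)
           (S : Subset n) where

    -- Only vertices outside `S` are required to be fixed; those in `S` may move. The swap,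
    -- conjugated by `to`, is the involutive automorphism that takes `u` to `v`.
    multisetRep-swap : ∀ u v → u ∉ S → v ∉ S →
      (∀ w → w ∉ S → w ≢ u → w ≢ v → swap (to u) (to v) (to w) ≡ to w) →
      multisetRep G u S ↭ multisetRep G v S
    multisetRep-swap u v u∉S v∉S fixes =
      subst (λ x → multisetRep G u S ↭ multisetRep G x S) φ-u
        (multisetRep-invariant G φ φ-hom φ-involutive S φ-∉ u)
      where
      σ = swap (to u) (to v)

      φ : Fin n → Fin n
      φ = from ∘ σ ∘ to

      to-φ : ∀ x → to (φ x) ≡ σ (to x)
      to-φ x = strictlyInverseˡ _

      φ-u : φ u ≡ v
      φ-u = trans (cong from (swap-first (to u) (to v))) (strictlyInverseʳ v)

      φ-v : φ v ≡ u
      φ-v = trans (cong from (swap-second (to u) (to v))) (strictlyInverseʳ u)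

      φ-involutive : ∀ x → φ (φ x) ≡ x
      φ-involutive x = trans (cong (from ∘ σ) (to-φ x))
        (trans (cong from (swap-involutive (to u) (to v) (to x))) (strictlyInverseʳ x))

      φ-hom : ∀ x y → Adj x y → Adj (φ x) (φ y)
      φ-hom x y xy = adj⇐ _ _ (subst₂ (λ p q → proj₁ p ≢ proj₁ q) (sym (to-φ x)) (sym (to-φ y))
        (swap-hom (to u) (to v) (to x) (to y) (adj⇒ x y xy)))

      φ-∉ : ∀ x → x ∉ S → φ x ∉ S
      φ-∉ x x∉S with x ≟ u
      ... | yes refl = subst (_∉ S) (sym φ-u) v∉S
      ... | no  x≢u with x ≟ v
      ...   | yes refl = subst (_∉ S) (sym φ-v) u∉S
      ...   | no  x≢v  =
        subst (_∉ S) (sym (trans (cong from (fixes x x∉S x≢u x≢v)) (strictlyInverseʳ x))) x∉S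

    module _ (resolving : OuterMultisetResolving G S) where

      -- Within one part the swap is the transposition of `u` and `v`, so it fixes every other
      -- vertex.
      ∉-distinct-parts : ∀ u v → u ∉ S → v ∉ S → u ≢ v → part u ≢ part v
      ∉-distinct-parts u v u∉S v∉S u≢v same = resolving u v u∉S v∉S u≢v
        (multisetRep-swap u v u∉S v∉S λ w _ w≢u w≢v →
          swap-fixes-same-part (to u) (to v) (to w) same
            (w≢u ∘ to-injective) (w≢v ∘ to-injective))

      -- By `∉-distinct-parts`, any third vertex outside `S` avoids the parts of `u` and `v`, so
      -- exchanging these parts leaves it in place.
      ∉-unique : ∀ u v → u ∉ S → v ∉ S → u ≡ v
      ∉-unique u v u∉S v∉S = decidable-stable (u ≟ v) λ u≢v →
        resolving u v u∉S v∉S u≢v (multisetRep-swap u v u∉S v∉S λ w w∉S w≢u w≢v →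
          swap-other (to u) (to v) (to w) (∉-distinct-parts w u w∉S u∉S w≢u) (∉-distinct-parts w v w∉S v∉S w≢v))

-- Vacuous: `x` is the only vertex outside, so there is no pair to distinguish.
resolving-∁⁅x⁆ : ∀ {n} (G : ConnectedGraph n) x → OuterMultisetResolving G (∁ ⁅ x ⁆)
resolving-∁⁅x⁆ G x u v u∉ v∉ u≢v =
  contradiction (trans (x∈⁅y⁆⇒x≡y x (x∉∁p⇒x∈p u∉)) (sym (x∈⁅y⁆⇒x≡y x (x∉∁p⇒x∈p v∉)))) u≢v

dimₘₛ≤n∸1 : ∀ {n} (G : ConnectedGraph n) → Fin n → dimₘₛ G ≤ n ∸ 1
dimₘₛ≤n∸1 {n} G x = proj₂ (proj₂ (minimumResolving G)) (n ∸ 1)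
  ( ∁ ⁅ x ⁆ , resolving-∁⁅x⁆ G x
  , trans (∣∁p∣≡n∸∣p∣ ⁅ x ⁆) (cong (n ∸_) (∣⁅x⁆∣≡1 x)))

-- Gives all parts one index type, so that vertices of different parts can be exchanged; `cast` is
-- needed because the sizes agree only propositionally.
Σ-constant-↔ : ∀ {k s} {f : Fin k → ℕ} → (∀ i → f i ≡ s) → Σ (Fin k) (Fin ∘ f) ↔ (Fin k × Fin s)
Σ-constant-↔ f≡s = mk↔ₛ′
  (λ { (i , a) → i , cast (f≡s i) a }) (λ { (i , a) → i , cast (sym (f≡s i)) a })
  (λ { (i , a) → cong (i ,_) (cast-involutive (f≡s i) (sym (f≡s i)) a) })
  (λ { (i , a) → cong (i ,_) (cast-involutive (sym (f≡s i)) (f≡s i) a) })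

mainTheorem6 : (k : ℕ) → 2 ≤ k →
    (r : Vec ℕ k) →
    (∀ (i j : Fin k) → lookup r i ≡ lookup r j) →
    (∀ (i : Fin k) → 2 ≤ lookup r i) →
    (n : ℕ) → sum r ≡ n →
    (m : ℕ) (G : ConnectedGraph m) →
    ConnectedGraph.graph G ≅ completeMultipartite r →
    dimₘₛ G ≡ n ∸ 1
mainTheorem6 k 2≤k r equal 2≤r n sum≡n m G G≅K =
  trans (≤-antisym (dimₘₛ≤n∸1 G vertex) m∸1≤dim) (cong (_∸ 1) m≡n)
  where
  open _≅_ G≅K using (bijection; adj⇔)

  -- A reference part, whose size serves as the common size `s`.
  i₀ : Fin k
  i₀ = fromℕ< (≤-trans (n≤1+n 1) 2≤k)

  s : ℕ
  s = lookup r i₀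

  I : Fin m ↔ (Fin k × Fin s)
  I = ↔-trans bijection (Σ-constant-↔ (λ i → equal i i₀))

  vertex : Fin m
  vertex = Inverse.from I (i₀ , fromℕ< (≤-trans (n≤1+n 1) (2≤r i₀)))

  -- Counting vertices: both sides equal `k * s`.
  m≡n : m ≡ n
  m≡n = trans (↔⇒≡ (↔-trans I (↔-sym *↔×)))
          (trans (sym (sum-constant r s (λ i → equal i i₀))) sum≡n)

  m∸1≤dim : m ∸ 1 ≤ dimₘₛ G
  m∸1≤dim with minimumResolving G
  -- `S` attains the minimum, and matching `refl` replaces the dimension by its cardinality.
  ... | _ , (S , resolving , refl) , _ = ∸-monoˡ-≤ 1 (∉-unique⇒n≤1+∣p∣ S
    (∉-unique G I (λ u v → Equivalence.to (adj⇔ u v)) (λ u v → Equivalence.from (adj⇔ u v))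
      S resolving))
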